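{- Fix a first-order theory (over program variables with integer values) that is Cook-expressive for flowcharts. Let $H_{\mathbb{FC}}$ be the mapping defined in the context. Then $H_{\mathbb{FC}}$ is a verification functor for the morphisms arising from flowchart block diagrams: for all flowcharts $A,B$, $H_{\mathbb{FC}}([\![\mathsf{Seq}(A,B)]\!]) = H_{\mathbb{FC}}([\![B]\!])\circ H_{\mathbb{FC}}([\![A]\!])$, $H_{\mathbb{FC}}([\![\mathsf{Par}(A,B)]\!]) = H_{\mathbb{FC}}([\![A]\!])\times H_{\mathbb{FC}}([\![B]\!])$, and whenever $[\![A]\!]: X\uplus Z\to Y\uplus Z$, for all $P\in H_{\mathbb{FC}}(X)$, $R\in H_{\mathbb{FC}}(Y)$: $(P,R)\in H_{\mathbb{FC}}([\![\mathsf{Fb}(A)]\!])$ iff there is $Q\in H_{\mathbb{FC}}(Z)$ with $((P,Q),(R,Q))\in H_{\mathbb{FC}}([\![A]\!])$.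
   Context: $\mathsf{Store}$ is the set of maps $\rho:\mathsf{Var}\to\mathbb{Z}$ from program variables to integers. Flowcharts are built from basic flowcharts — identity $\mathsf{id}$, assignment $x:=t$, join $\Delta$, twist, and conditional fork $\mathrm{cond}_b$ — by sequential composition $\mathsf{Seq}$, parallel composition $\mathsf{Par}$ and feedback $\mathsf{Fb}$. Semantics: objects are $\emptyset,\mathsf{Store},\mathsf{Store}\uplus\mathsf{Store},\dots$ (finite disjoint unions); $[\![\mathsf{id}]\!](\rho)=\rho$; $[\![x:=t]\!](\rho)=\rho[t_\rho/x]$; $[\![\Delta]\!]:\mathsf{Store}\uplus\mathsf{Store}\to\mathsf{Store}$, $\mathsf{inj}_i(\rho)\mapsto\rho$; twist swaps the summands of $\mathsf{Store}\uplus\mathsf{Store}$; $[\![\mathrm{cond}_b]\!](\rho)=\mathsf{inj}_0(\rho)$ if $\neg b_\rho$ and $\mathsf{inj}_1(\rho)$ otherwise (here $t:\mathsf{Store}\to\mathbb{Z}$, $b:\mathsf{Store}\to\mathbb{B}$). $[\![\mathsf{Seq}(A,B)]\!]=[\![B]\!]\circ[\![A]\!]$, $[\![\mathsf{Par}(A,B)]\!]=[\![A]\!]\uplus[\![B]\!]$, and $[\![\mathsf{Fb}(A)]\!]=\mathsf{Tr}([\![A]\!])$, where for a relation $f:X\uplus Z\to Y\uplus Z$ the trace is: $x\,\mathsf{Tr}(f)\,y$ iff there exist $z_0,\dots,z_n$ with $\mathsf{inj}_0 x\, f\, \mathsf{inj}_1 z_0$, $\mathsf{inj}_1 z_i\,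 f\,\mathsf{inj}_1 z_{i+1}$ for $i<n$, and $\mathsf{inj}_1 z_n\, f\,\mathsf{inj}_0 y$ (semantic values are partial functions). Cook-expressive: for every flowchart $A$ and precondition formula $P$ the strongest postcondition $\mathsf{SPC}(A,P)$ (describing exactly the outputs of $[\![A]\!]$ on inputs satisfying $P$) is expressible by a formula. A formula over $X_0\uplus X_1$ is identified with a pair of formulas over $X_0$ and $X_1$, connectives acting pointwise. $H_{\mathbb{FC}}(X)$ is the set of formulas describing subsets of $X$, pre-ordered by $P\sqsubseteq R$ iff $P\to R$ is provable in the theory, with $H_{\mathbb{FC}}(X\uplus Y)=H_{\mathbb{FC}}(X)\times H_{\mathbb{FC}}(Y)$; for a flowchart $A$, $(P,Q)\in H_{\mathbb{FC}}([\![A]\!])$ iff $\mathsf{SPC}(A,P)\to Q$. Composition of relations and product of relations are the usual ones.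
   Formalization: The trace also allows direct exits inj₀ x f inj₀ y (without them the Fb clause fails for Par(id,id)); SPC must also provably imply every true postcondition; the theory is true in ℤ; Var is countably infinite; each t, b depends on finitely many variables. -}

module Defs where

open import Data.Bool.Base using (Bool; if_then_else_; T)
open import Data.Fin.Base using (Fin; zero; suc; opposite; splitAt; _↑ˡ_; _↑ʳ_)
open import Data.Integer.Base using (ℤ)
open import Data.List.Base using (List; []; _∷_; map)
open import Data.List.Membership.Propositional using (_∈_)
open import Data.Nat.Base using (ℕ; zero; suc; _+_; _<_)
open import Data.Nat.Properties using (_≟_)
open import Data.Product.Base using (∃-syntax; _×_; _,_; map₁)
open import Data.Sum.Base using (_⊎_) renaming (map to map⊎)
open import Data.Sum.Relation.Binary.Pointwise using (Pointwise)
open import Data.Vec.Base using (Vec; []; _∷_; lookup)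
open import Data.Empty using (⊥)
open import Function.Bundles using (_⇔_)
open import Level using (0ℓ)
open import Relation.Binary.Core using (REL; Rel)
open import Relation.Binary.Construct.Closure.ReflexiveTransitive using (Star)
open import Relation.Binary.PropositionalEquality using (_≡_; _≗_)
open import Relation.Nullary.Decidable.Core using (does)

------------------------------------------------------------------------
-- Stores

-- There are countably many program variables.
Var : Set
Var = ℕ

Store : Set
Store = Var → ℤ

_[_↦_] : Store → Var → ℤ → Store
(ρ [ x ↦ v ]) y = if does (y ≟ x) then v else ρ y

-- The object Store ⊎ … ⊎ Store with n summands.  Keeping only the number of
-- summands makes the associativity and unit laws of ⊎ hold on objects, and
-- ⊎ of objects is addition.
State : ℕ → Set
State n = Fin n × Store

-- Stores are compared as maps, i.e. pointwise.
_≈_ : ∀ {n} → Rel (State n) 0ℓ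
(i , ρ) ≈ (j , σ) = i ≡ j × ρ ≗ σ

inj₀ : ∀ {m} n → State m → State (m + n)
inj₀ n (i , ρ) = i ↑ˡ n , ρ

inj₁ : ∀ m {n} → State n → State (m + n)
inj₁ m (i , ρ) = m ↑ʳ i , ρ

split : ∀ m {n} → State (m + n) → State m ⊎ State n
split m (i , ρ) = map⊎ (_, ρ) (_, ρ) (splitAt m i)

------------------------------------------------------------------------
-- Flowcharts

infixr 9 _∘ᴿ_
_∘ᴿ_ : ∀ {A B C : Set} → REL B C 0ℓ → REL A B 0ℓ → REL A C 0ℓ
(g ∘ᴿ f) x z = ∃[ y ] f x y × g y z

-- The integer and boolean expressions that may occur in flowcharts.  An
-- expression mentions finitely many program variables: its value depends only
-- on the variables below some bound.
DependsOnFinitelyMany : {V : Set} → (Store → V) → Set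
DependsOnFinitelyMany f =
  ∃[ N ] (∀ ρ σ → (∀ x → x < N → ρ x ≡ σ x) → f ρ ≡ f σ)

record Expressions : Set₁ where
  field
    IExp   : Set
    BExp   : Set
    evalI  : IExp → Store → ℤ
    evalB  : BExp → Store → Bool
    finI   : ∀ t → DependsOnFinitelyMany (evalI t)
    finB   : ∀ b → DependsOnFinitelyMany (evalB b)

module _ (E : Expressions) where
  open Expressions E

  data Flowchart : ℕ → ℕ → Set where
    ident  : Flowchart 1 1
    assign : Var → IExp → Flowchart 1 1
    join   : Flowchart 2 1
    twist  : Flowchart 2 2
    cond   : BExp → Flowchart 1 2
    Seq    : ∀ {l m n} → Flowchart l m → Flowchart m n → Flowchart l n
    Par    : ∀ {m n m′ n′} → Flowchart m n → Flowchart m′ n′ →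
             Flowchart (m + m′) (n + n′)
    Fb     : ∀ {m n} k → Flowchart (m + k) (n + k) → Flowchart m n

graph : ∀ {m n} → (State m → State n) → REL (State m) (State n) 0ℓ
graph f s t = t ≈ f s

_⊎ᴿ_ : ∀ {m n m′ n′} → REL (State m) (State n) 0ℓ → REL (State m′) (State n′) 0ℓ →
       REL (State (m + m′)) (State (n + n′)) 0ℓ
_⊎ᴿ_ {m} {n} f g s t = Pointwise f g (split m s) (split n t)

-- The feedback sequence z₀, …, zₙ may be empty: the first summand is the case
-- where control leaves without passing through the feedback object.
Tr : ∀ {m n} k → REL (State (m + k)) (State (n + k)) 0ℓ → REL (State m) (State n) 0ℓ
Tr {m} {n} k f x y =
  f (inj₀ k x) (inj₀ k y)
  ⊎ (∃[ z₀ ] ∃[ zₙ ]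
       f (inj₀ k x) (inj₁ n z₀)
       × Star (λ z z′ → f (inj₁ m z) (inj₁ n z′)) z₀ zₙ
       × f (inj₁ m zₙ) (inj₀ k y))

module _ {E : Expressions} where
  open Expressions E

  ⟦_⟧ : ∀ {m n} → Flowchart E m n → REL (State m) (State n) 0ℓ
  ⟦ ident ⟧      = graph λ s → s
  ⟦ assign x t ⟧ = graph λ (i , ρ) → i , ρ [ x ↦ evalI t ρ ]
  ⟦ join ⟧       = graph λ (_ , ρ) → zero , ρ
  ⟦ twist ⟧      = graph (map₁ opposite)
  ⟦ cond b ⟧     = graph λ (_ , ρ) → (if evalB b ρ then suc zero else zero) , ρ
  ⟦ Seq A B ⟧    = ⟦ B ⟧ ∘ᴿ ⟦ A ⟧
  ⟦ Par A B ⟧    = ⟦ A ⟧ ⊎ᴿ ⟦ B ⟧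
  ⟦ Fb k A ⟧     = Tr k ⟦ A ⟧

------------------------------------------------------------------------
-- First-order logic with equality, interpreted over ℤ

-- A first-order signature together with its interpretation over ℤ.
record Language : Set₁ where
  field
    Fun  : ℕ → Set
    Pred : ℕ → Set
    funᴵ  : ∀ {k} → Fun k → Vec ℤ k → ℤ
    predᴵ : ∀ {k} → Pred k → Vec ℤ k → Bool

_•_ : ∀ {A : Set} → A → (ℕ → A) → (ℕ → A)
(a • f) zero    = a
(a • f) (suc x) = f x

module _ (L : Language) where
  open Language L

  data Term : Set where
    var : ℕ → Term
    fun : ∀ {k} → Fun k → Vec Term k → Term

  -- De Bruijn syntax whose free variables are the program variables: below n
  -- quantifiers, program variable x is  var (n + x).  The connectives ¬, ∧, ∨, ∃
  -- are the classically definable ones.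
  data Formula : Set where
    _≐_  : Term → Term → Formula
    pred : ∀ {k} → Pred k → Vec Term k → Formula
    ⊥ᶠ   : Formula
    _⊃_  : Formula → Formula → Formula
    ∀ᶠ   : Formula → Formula

  infixr 5 _⊃_
  infix  6 _≐_

module _ {L : Language} where
  open Language L

  mutual
    _[_]ₜ : Term L → (ℕ → Term L) → Term L
    var x    [ θ ]ₜ = θ x
    fun f ts [ θ ]ₜ = fun f (ts [ θ ]ₜₛ)

    _[_]ₜₛ : ∀ {k} → Vec (Term L) k → (ℕ → Term L) → Vec (Term L) k
    []       [ θ ]ₜₛ = []
    (t ∷ ts) [ θ ]ₜₛ = (t [ θ ]ₜ) ∷ (ts [ θ ]ₜₛ)

  shift : ℕ → Term L
  shift x = var (suc x)

  _[_]ᶠ : Formula L → (ℕ → Term L) → Formula L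
  (s ≐ t)     [ θ ]ᶠ = (s [ θ ]ₜ) ≐ (t [ θ ]ₜ)
  pred p ts   [ θ ]ᶠ = pred p (ts [ θ ]ₜₛ)
  ⊥ᶠ          [ θ ]ᶠ = ⊥ᶠ
  (φ ⊃ ψ)     [ θ ]ᶠ = (φ [ θ ]ᶠ) ⊃ (ψ [ θ ]ᶠ)
  ∀ᶠ φ        [ θ ]ᶠ = ∀ᶠ (φ [ var 0 • (λ x → θ x [ shift ]ₜ) ]ᶠ)

  mutual
    value : Store → Term L → ℤ
    value ρ (var x)    = ρ x
    value ρ (fun f ts) = funᴵ f (values ρ ts)

    values : ∀ {k} → Store → Vec (Term L) k → Vec ℤ k
    values ρ []       = []
    values ρ (t ∷ ts) = value ρ t ∷ values ρ ts

  infix 4 _⊨_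
  _⊨_ : Store → Formula L → Set
  ρ ⊨ s ≐ t     = value ρ s ≡ value ρ t
  ρ ⊨ pred p ts = T (predᴵ p (values ρ ts))
  ρ ⊨ ⊥ᶠ        = ⊥
  ρ ⊨ φ ⊃ ψ     = ρ ⊨ φ → ρ ⊨ ψ
  ρ ⊨ ∀ᶠ φ      = ∀ v → (v • ρ) ⊨ φ

-- A theory is given by its axioms; free variables of axioms are read as
-- universally quantified.
Theory : Language → Set₁
Theory L = Formula L → Set

module _ {L : Language} where

  -- Classical natural deduction.
  infix 3 _∣_⊢_
  data _∣_⊢_ (𝒯 : Theory L) (Γ : List (Formula L)) : Formula L → Set where
    axiom  : ∀ {φ} → 𝒯 φ → 𝒯 ∣ Γ ⊢ φ
    hyp    : ∀ {φ} → φ ∈ Γ → 𝒯 ∣ Γ ⊢ φ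
    ⊃-I    : ∀ {φ ψ} → 𝒯 ∣ φ ∷ Γ ⊢ ψ → 𝒯 ∣ Γ ⊢ φ ⊃ ψ
    ⊃-E    : ∀ {φ ψ} → 𝒯 ∣ Γ ⊢ φ ⊃ ψ → 𝒯 ∣ Γ ⊢ φ → 𝒯 ∣ Γ ⊢ ψ
    raa    : ∀ {φ} → 𝒯 ∣ (φ ⊃ ⊥ᶠ) ∷ Γ ⊢ ⊥ᶠ → 𝒯 ∣ Γ ⊢ φ
    ∀-I    : ∀ {φ} → 𝒯 ∣ map (_[ shift ]ᶠ) Γ ⊢ φ → 𝒯 ∣ Γ ⊢ ∀ᶠ φ
    ∀-E    : ∀ {φ} t → 𝒯 ∣ Γ ⊢ ∀ᶠ φ → 𝒯 ∣ Γ ⊢ φ [ t • var ]ᶠ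
    ≐-refl : ∀ t → 𝒯 ∣ Γ ⊢ t ≐ t
    ≐-E    : ∀ {s t} φ → 𝒯 ∣ Γ ⊢ s ≐ t → 𝒯 ∣ Γ ⊢ φ [ s • var ]ᶠ → 𝒯 ∣ Γ ⊢ φ [ t • var ]ᶠ

  TrueInℤ : Theory L → Set
  TrueInℤ 𝒯 = ∀ φ → 𝒯 φ → ∀ ρ → ρ ⊨ φ

------------------------------------------------------------------------
-- Assertions, strongest postconditions and the mapping H

-- Formulas describing subsets of State n, one formula for each summand.  The
-- pair of P : Assertion L m and Q : Assertion L n is  P ++ Q.
Assertion : Language → ℕ → Set
Assertion L n = Vec (Formula L) n

module _ {L : Language} where

  infix 4 _⊩_
  _⊩_ : ∀ {n} → State n → Assertion L n → Set
  (i , ρ) ⊩ P = ρ ⊨ lookup P i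

  infix 4 _⊢_⊑_
  _⊢_⊑_ : ∀ {n} → Theory L → Assertion L n → Assertion L n → Set
  𝒯 ⊢ P ⊑ R = ∀ i → 𝒯 ∣ [] ⊢ lookup P i ⊃ lookup R i

  Output : ∀ {m n} → REL (State m) (State n) 0ℓ → Assertion L m → State n → Set
  Output f P y = ∃[ x ] x ⊩ P × f x y

  -- S describes exactly the outputs of f on inputs satisfying P, and it is
  -- strongest: below, in the order ⊑ of the theory, every assertion that holds
  -- of all these outputs.  Hence SPC f P is unique up to ⊑-equivalence.
  record IsSPC (𝒯 : Theory L) {m n} (f : REL (State m) (State n) 0ℓ)
               (P : Assertion L m) (S : Assertion L n) : Set where
    field
      exact     : ∀ y → y ⊩ S ⇔ Output f P y
      strongest : ∀ Q → (∀ y → Output f P y → y ⊩ Q) → 𝒯 ⊢ S ⊑ Q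

  CookExpressive : Expressions → Theory L → Set
  CookExpressive E 𝒯 = ∀ {m n} (A : Flowchart E m n) (P : Assertion L m) →
                       ∃[ S ] IsSPC 𝒯 ⟦ A ⟧ P S

  H : (𝒯 : Theory L) → ∀ {m n} → REL (State m) (State n) 0ℓ →
      REL (Assertion L m) (Assertion L n) 0ℓ
  H 𝒯 f P Q = ∃[ S ] IsSPC 𝒯 f P S × 𝒯 ⊢ S ⊑ Q

{-# OPTIONS --safe #-}

-- By soundness of the theory and existence of strongest postconditions, H relates
-- P to Q exactly when the Hoare triple {P} f {Q} is valid.  For feedback this
-- leaves the task of expressing a loop invariant, for which we take the weakest
-- liberal precondition of the loop entered at a feedback wire.  That loop is itself
-- a flowchart, obtained by joining extra entry wires onto the feedback wires.  Weakest
-- liberal preconditions come from strongest postconditions: a flowchart only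
-- touches the variables below some N, so take the postcondition S of the
-- precondition x_i = x_{N+i} (i < N), which relates final values (below N) to initial
-- values (from N on); then wlp(R) is the N-fold universal closure of S ⊃ R.

module Submission where

open import Defs
open import Data.Bool.Base using (T; true; false; if_then_else_)
open import Data.Bool.Properties using (T?)
open import Data.Empty using (⊥-elim)
open import Data.Fin.Base using (Fin; zero; suc; toℕ; fromℕ<; cast; splitAt; _↑ˡ_; _↑ʳ_)
import Data.Fin.Base as Fin
open import Data.Fin.Properties as Fin
  using (toℕ<n; toℕ-fromℕ<; toℕ-injective; toℕ-↑ˡ; toℕ-↑ʳ; toℕ-cast; cast-is-id;
         splitAt-↑ˡ; splitAt-↑ʳ; splitAt⁻¹-↑ˡ; splitAt⁻¹-↑ʳ; splitAt-join; join-splitAt)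
open import Data.Integer.Base using (ℤ)
import Data.Integer.Properties as ℤ
open import Data.List.Base using ([])
open import Data.List.Relation.Unary.All as All using (All; []; _∷_)
import Data.List.Relation.Unary.All.Properties as All
open import Data.Nat.Base using (ℕ; zero; suc; _+_; _≤_; _<_; _≡ᵇ_; _⊔_; s≤s⁻¹)
open import Data.Nat.Properties as ℕ
  using (_≟_; _<?_; <⇒≱; ≮⇒≥; ≤-trans; <-≤-trans; m≤n⇒m≤1+n; m≤m+n; m≤m⊔n; m≤n⊔m;
         m+[n∸m]≡n; +-assoc; ≤-refl)
open import Data.Product.Base using (_×_; _,_; ∃-syntax; proj₁; proj₂; map₁)
open import Data.Sum.Base using (_⊎_)
  renaming (inj₁ to left; inj₂ to right; map to map⊎; [_,_]′ to either)
open import Data.Sum.Relation.Binary.Pointwise using (Pointwise)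
  renaming (inj₁ to leftᴾ; inj₂ to rightᴾ)
open import Data.Vec.Base using (Vec; []; _∷_; _++_; lookup; tabulate; replicate; _[_]≔_)
open import Data.Vec.Properties
  using (lookup-++ˡ; lookup-++ʳ; lookup∘tabulate; lookup-replicate; lookup∘update; lookup∘update′)
open import Function.Base using (_∘_; id)
open import Function.Bundles using (_⇔_; mk⇔; module Equivalence)
open import Level using (0ℓ)
open import Relation.Binary.Core using (REL; Rel)
open import Relation.Binary.Construct.Closure.ReflexiveTransitive as Star using (Star; ε; _◅_)
open import Relation.Binary.PropositionalEquality
  using (_≡_; _≢_; _≗_; refl; sym; trans; cong; cong₂; subst; subst₂)
open import Relation.Nullary.Decidable using (yes; no; dec-false; decidable-stable)
open import Relation.Nullary.Negation.Core using (¬_; contradiction)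

open Equivalence using (to; from)

-- Soundness of first-order logic

AgreeBelow AgreeFrom : ℕ → Store → Store → Set
AgreeBelow N ρ σ = ∀ x → x < N → ρ x ≡ σ x
AgreeFrom  N ρ σ = ∀ x → N ≤ x → ρ x ≡ σ x

module _ {N : ℕ} {ρ σ : Store} where

  AgreeBelow-sym : AgreeBelow N ρ σ → AgreeBelow N σ ρ
  AgreeBelow-sym p x x<N = sym (p x x<N)

  AgreeBelow-weaken : ∀ {M} → M ≤ N → AgreeBelow N ρ σ → AgreeBelow M ρ σ
  AgreeBelow-weaken M≤N p x x<M = p x (<-≤-trans x<M M≤N)

  AgreeBelow-• : ∀ v → AgreeBelow N ρ σ → AgreeBelow N (v • ρ) (v • σ)
  AgreeBelow-• v p zero    _   = refl
  AgreeBelow-• v p (suc x) x<N = p x (≤-trans (m≤n⇒m≤1+n ≤-refl) x<N)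

module _ {L : Language} where
  open Language L

  mutual
    value-local : ∀ t → DependsOnFinitelyMany (λ ρ → value {L} ρ t)
    value-local (var x)    = suc x , λ _ _ p → p x ≤-refl
    value-local (fun f ts) with values-local ts
    ... | N , loc = N , λ ρ σ p → cong (funᴵ f) (loc ρ σ p)

    values-local : ∀ {k} (ts : Vec (Term L) k) → DependsOnFinitelyMany (λ ρ → values ρ ts)
    values-local []       = 0 , λ _ _ _ → refl
    values-local (t ∷ ts) with value-local t | values-local ts
    ... | M , locₜ | N , locₜₛ = M ⊔ N , λ ρ σ p →
      cong₂ _∷_ (locₜ  ρ σ (AgreeBelow-weaken (m≤m⊔n M N) p))
                (locₜₛ ρ σ (AgreeBelow-weaken (m≤n⊔m M N) p))

  LocalBelow : ℕ → Formula L → Set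
  LocalBelow N φ = ∀ {ρ σ} → AgreeBelow N ρ σ → ρ ⊨ φ → σ ⊨ φ

  LocalBelow-weaken : ∀ {M N} φ → M ≤ N → LocalBelow M φ → LocalBelow N φ
  LocalBelow-weaken φ M≤N loc p = loc (AgreeBelow-weaken M≤N p)

  -- Serves two ends: pointwise equal stores satisfy the same formulas, and a postcondition mentions
  -- only variables below some bound, which leaves higher variables free to hold saved values.
  ⊨-local : ∀ φ → ∃[ N ] LocalBelow N φ
  ⊨-local (s ≐ t) with value-local s | value-local t
  ... | M , locₛ | N , locₜ = M ⊔ N , λ {ρ} {σ} p e →
    trans (sym (locₛ ρ σ (AgreeBelow-weaken (m≤m⊔n M N) p)))
          (trans e (locₜ ρ σ (AgreeBelow-weaken (m≤n⊔m M N) p)))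
  ⊨-local (pred q ts) with values-local ts
  ... | N , loc = N , λ {ρ} {σ} p → subst (T ∘ predᴵ q) (loc ρ σ p)
  ⊨-local ⊥ᶠ = 0 , λ _ ()
  ⊨-local (φ ⊃ ψ) with ⊨-local φ | ⊨-local ψ
  ... | M , locφ | N , locψ = M ⊔ N , λ p f a →
    LocalBelow-weaken ψ (m≤n⊔m M N) locψ p
      (f (LocalBelow-weaken φ (m≤m⊔n M N) locφ (AgreeBelow-sym p) a))
  ⊨-local (∀ᶠ φ) with ⊨-local φ
  -- A binder shifts indices up by one, so agreement below `N` outside it gives at least agreement
  -- below `N` inside.
  ... | N , loc = N , λ p f v → loc (AgreeBelow-• v p) (f v)

  ⊨-resp-≗ : ∀ φ {ρ σ : Store} → ρ ≗ σ → ρ ⊨ φ → σ ⊨ φ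
  ⊨-resp-≗ φ e = proj₂ (⊨-local φ) (λ x _ → e x)

  -- Atoms are decidable, and `⊃` and `∀ᶠ` preserve stability. This makes the classical rule `raa`
  -- sound in a constructive metatheory.
  ⊨-stable : ∀ (φ : Formula L) {ρ} → ¬ ¬ (ρ ⊨ φ) → ρ ⊨ φ
  ⊨-stable (s ≐ t)     = decidable-stable (_ ℤ.≟ _)
  ⊨-stable (pred p ts) = decidable-stable (T? _)
  ⊨-stable ⊥ᶠ          = λ nn → nn λ ()
  ⊨-stable (φ ⊃ ψ)     = λ nn a → ⊨-stable ψ λ n → nn λ f → n (f a)
  ⊨-stable (∀ᶠ φ)      = λ nn v → ⊨-stable φ λ n → nn λ f → n (f v)

  mutual
    value-[] : ∀ (t : Term L) θ ρ → value ρ (t [ θ ]ₜ) ≡ value (value ρ ∘ θ) t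
    value-[] (var x)    θ ρ = refl
    value-[] (fun f ts) θ ρ = cong (funᴵ f) (values-[] ts θ ρ)

    values-[] : ∀ {k} (ts : Vec (Term L) k) θ ρ →
                values ρ (ts [ θ ]ₜₛ) ≡ values (value ρ ∘ θ) ts
    values-[] []       θ ρ = refl
    values-[] (t ∷ ts) θ ρ = cong₂ _∷_ (value-[] t θ ρ) (values-[] ts θ ρ)

  -- The substitution lemma. Both directions share one induction because `⊃` is contravariant on the
  -- left.
  ⊨-[] : ∀ (φ : Formula L) θ ρ → (ρ ⊨ φ [ θ ]ᶠ) ⇔ (value ρ ∘ θ ⊨ φ)
  ⊨-[] (s ≐ t)     θ ρ = mk⇔ (subst₂ _≡_ (value-[] s θ ρ) (value-[] t θ ρ))
                             (subst₂ _≡_ (sym (value-[] s θ ρ)) (sym (value-[] t θ ρ)))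
  ⊨-[] (pred p ts) θ ρ = mk⇔ (subst (T ∘ predᴵ p) (values-[] ts θ ρ))
                             (subst (T ∘ predᴵ p) (sym (values-[] ts θ ρ)))
  ⊨-[] ⊥ᶠ          θ ρ = mk⇔ id id
  ⊨-[] (φ ⊃ ψ)     θ ρ = mk⇔ (λ f → to (⊨-[] ψ θ ρ) ∘ f ∘ from (⊨-[] φ θ ρ))
                             (λ f → from (⊨-[] ψ θ ρ) ∘ f ∘ to (⊨-[] φ θ ρ))
  ⊨-[] (∀ᶠ φ)      θ ρ =
    mk⇔ (λ f v → ⊨-resp-≗ φ (lift v) (to (⊨-[] φ _ (v • ρ)) (f v)))
        (λ f v → from (⊨-[] φ _ (v • ρ)) (⊨-resp-≗ φ (sym ∘ lift v) (f v)))
    where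
    lift : ∀ v → value (v • ρ) ∘ (var 0 • (λ x → θ x [ shift ]ₜ)) ≗ v • (value ρ ∘ θ)
    lift v zero    = refl
    lift v (suc x) = value-[] (θ x) shift (v • ρ)

  ⊨-instance : ∀ (φ : Formula L) t ρ → (ρ ⊨ φ [ t • var ]ᶠ) ⇔ ((value ρ t • ρ) ⊨ φ)
  ⊨-instance φ t ρ = mk⇔ (⊨-resp-≗ φ e ∘ to (⊨-[] φ _ ρ))
                         (from (⊨-[] φ _ ρ) ∘ ⊨-resp-≗ φ (sym ∘ e))
    where
    e : value ρ ∘ (t • var) ≗ value ρ t • ρ
    e zero    = refl
    e (suc x) = refl

  soundness : ∀ {𝒯 : Theory L} → TrueInℤ 𝒯 →
              ∀ {Γ φ} → 𝒯 ∣ Γ ⊢ φ → ∀ ρ → All (ρ ⊨_) Γ → ρ ⊨ φ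
  soundness valid (axiom a)        ρ γ = valid _ a ρ
  soundness valid (hyp φ∈Γ)        ρ γ = All.lookup γ φ∈Γ
  soundness valid (⊃-I d)          ρ γ = λ a → soundness valid d ρ (a ∷ γ)
  soundness valid (⊃-E d e)        ρ γ = soundness valid d ρ γ (soundness valid e ρ γ)
  soundness valid (raa {φ} d)      ρ γ = ⊨-stable φ λ n → soundness valid d ρ (n ∷ γ)
  soundness valid (∀-I d)          ρ γ = λ v → soundness valid d (v • ρ)
    (All.map⁺ (All.map (λ {ψ} → from (⊨-[] ψ shift (v • ρ))) γ))
  soundness valid (∀-E {φ} t d)    ρ γ = from (⊨-instance φ t ρ) (soundness valid d ρ γ _)
  soundness valid (≐-refl t)       ρ γ = refl
  soundness valid (≐-E {s} {t} φ d e) ρ γ = from (⊨-instance φ t ρ)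
    (subst (λ v → (v • ρ) ⊨ φ) (soundness valid d ρ γ)
      (to (⊨-instance φ s ρ) (soundness valid e ρ γ)))

-- Hoare triples

  Triple : ∀ {m n} → REL (State m) (State n) 0ℓ → REL (Assertion L m) (Assertion L n) 0ℓ
  Triple f P Q = ∀ {x y} → x ⊩ P → f x y → y ⊩ Q

  -- Soundness turns the provable implication from the postcondition to `Q` into truth on every
  -- output. Conversely, `strongest` turns truth on every output into provability.
  H⇔Triple : ∀ {𝒯 : Theory L} → TrueInℤ 𝒯 →
             ∀ {m n} {f : REL (State m) (State n) 0ℓ} {P Q} →
             ∃[ S ] IsSPC 𝒯 f P S → H 𝒯 f P Q ⇔ Triple f P Q
  H⇔Triple valid {Q = Q} (S , spc) = mk⇔
    (λ (S′ , spc′ , S′⊑Q) {x} {y} xP fxy →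
      soundness valid (S′⊑Q (proj₁ y)) (proj₂ y) [] (from (IsSPC.exact spc′ y) (x , xP , fxy)))
    (λ triple → S , spc , IsSPC.strongest spc Q λ y (x , xP , fxy) → triple xP fxy)

-- Sums of states

data SumView {m n} : State (m + n) → Set where
  in₀ : ∀ x → SumView (inj₀ n x)
  in₁ : ∀ z → SumView (inj₁ m z)

sumView : ∀ {m n} (s : State (m + n)) → SumView {m} s
sumView {m} {n} (i , ρ) with splitAt m i in eq
... | left  j rewrite sym (splitAt⁻¹-↑ˡ {m} {n} {i} eq) = in₀ (j , ρ)
... | right j rewrite sym (splitAt⁻¹-↑ʳ {m} {n} {i} eq) = in₁ (j , ρ)

split-inj₀ : ∀ {m} n (x : State m) → split m (inj₀ n x) ≡ left x
split-inj₀ {m} n (i , ρ) = cong (map⊎ (_, ρ) (_, ρ)) (splitAt-↑ˡ m i n)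

split-inj₁ : ∀ m {n} (z : State n) → split m (inj₁ m z) ≡ right z
split-inj₁ m {n} (i , ρ) = cong (map⊎ (_, ρ) (_, ρ)) (splitAt-↑ʳ m n i)

module _ {L : Language} {m n} (P : Assertion L m) (Q : Assertion L n) where

  ⊩-inj₀ : ∀ x → inj₀ n x ⊩ (P ++ Q) ⇔ x ⊩ P
  ⊩-inj₀ (i , ρ) = mk⇔ (subst (ρ ⊨_) (lookup-++ˡ P Q i)) (subst (ρ ⊨_) (sym (lookup-++ˡ P Q i)))

  ⊩-inj₁ : ∀ z → inj₁ m z ⊩ (P ++ Q) ⇔ z ⊩ Q
  ⊩-inj₁ (i , ρ) = mk⇔ (subst (ρ ⊨_) (lookup-++ʳ P Q i)) (subst (ρ ⊨_) (sym (lookup-++ʳ P Q i)))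

module _ {m n m′ n′}
         {f : REL (State m) (State n) 0ℓ} {g : REL (State m′) (State n′) 0ℓ} where

  ⊎ᴿ-inj₀ : ∀ {x y} → f x y → (f ⊎ᴿ g) (inj₀ m′ x) (inj₀ n′ y)
  ⊎ᴿ-inj₀ {x} {y} fxy =
    subst₂ (Pointwise f g) (sym (split-inj₀ m′ x)) (sym (split-inj₀ n′ y)) (leftᴾ fxy)

  ⊎ᴿ-inj₁ : ∀ {x y} → g x y → (f ⊎ᴿ g) (inj₁ m x) (inj₁ n y)
  ⊎ᴿ-inj₁ {x} {y} gxy =
    subst₂ (Pointwise f g) (sym (split-inj₁ m x)) (sym (split-inj₁ n y)) (rightᴾ gxy)

  ⊎ᴿ-elim : (C : REL (State (m + m′)) (State (n + n′)) 0ℓ) →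
            (∀ {x y} → f x y → C (inj₀ m′ x) (inj₀ n′ y)) →
            (∀ {x y} → g x y → C (inj₁ m x) (inj₁ n y)) →
            ∀ {s t} → (f ⊎ᴿ g) s t → C s t
  ⊎ᴿ-elim C c₀ c₁ {s} {t} r with sumView {m} s | sumView {n} t
  ... | in₀ x | in₀ y with leftᴾ fxy ←
    subst₂ (Pointwise f g) (split-inj₀ m′ x) (split-inj₀ n′ y) r = c₀ fxy
  ... | in₀ x | in₁ y with () ←
    subst₂ (Pointwise f g) (split-inj₀ m′ x) (split-inj₁ n y) r
  ... | in₁ x | in₀ y with () ←
    subst₂ (Pointwise f g) (split-inj₁ m x) (split-inj₀ n′ y) r
  ... | in₁ x | in₁ y with rightᴾ gxy ←
    subst₂ (Pointwise f g) (split-inj₁ m x) (split-inj₁ n y) r = c₁ gxy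

-- Flowcharts act only on finitely many variables

AgreeBelow∧AgreeFrom⇒≗ : ∀ {N ρ σ} → AgreeBelow N ρ σ → AgreeFrom N ρ σ → ρ ≗ σ
AgreeBelow∧AgreeFrom⇒≗ {N} p q x with x <? N
... | yes x<N = p x x<N
... | no  x≮N = q x (≮⇒≥ x≮N)

-- Supplies the stores of a transferred run: low values from the original run, high values from the
-- new initial store.
splice : ℕ → Store → Store → Store
splice N ρ σ x with x <? N
... | yes _ = ρ x
... | no  _ = σ x

module _ (N : ℕ) (ρ σ : Store) where

  splice-below : AgreeBelow N ρ (splice N ρ σ)
  splice-below x x<N with x <? N
  ... | yes _   = refl
  ... | no  x≮N = contradiction x<N x≮N

  splice-from : AgreeFrom N σ (splice N ρ σ)
  splice-from x N≤x with x <? N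
  ... | yes x<N = contradiction N≤x (<⇒≱ x<N)
  ... | no  _   = refl

-- Variables from `N` on are carried along unchanged and do not influence the run, so they may be
-- replaced by any others that coincide before and after.
record Framed {m n} (N : ℕ) (f : REL (State m) (State n) 0ℓ) : Set where
  field
    preserves : ∀ {i j ρ σ} → f (i , ρ) (j , σ) → AgreeFrom N ρ σ
    transfer  : ∀ {i j ρ σ ρ′ σ′} → f (i , ρ) (j , σ) →
                AgreeBelow N ρ ρ′ → AgreeBelow N σ σ′ → AgreeFrom N ρ′ σ′ →
                f (i , ρ′) (j , σ′)

  resp-≈ : ∀ {s s′ t t′} → s ≈ s′ → t ≈ t′ → f s t → f s′ t′
  resp-≈ (refl , e) (refl , e′) r = transfer r (λ x _ → e x) (λ x _ → e′ x)
    λ x N≤x → trans (sym (e x)) (trans (preserves r x N≤x) (e′ x))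

open Framed

Framed-weaken : ∀ {m n M N} {f : REL (State m) (State n) 0ℓ} → M ≤ N → Framed M f → Framed N f
Framed-weaken {M = M} {N} {f} M≤N F = record
  { preserves = λ r x N≤x → preserves F r x (≤-trans M≤N N≤x)
  ; transfer  = λ r p q e → transfer F r (AgreeBelow-weaken M≤N p) (AgreeBelow-weaken M≤N q)
      (fromM r p q e)
  }
  where
  fromM : ∀ {i j ρ σ ρ′ σ′} → f (i , ρ) (j , σ) → AgreeBelow N ρ ρ′ → AgreeBelow N σ σ′ →
          AgreeFrom N ρ′ σ′ → AgreeFrom M ρ′ σ′
  fromM r p q e x M≤x with x <? N
  -- Between `M` and `N` the old run leaves `x` alone, and the new stores agree with the old ones
  -- there.
  ... | yes x<N = trans (sym (p x x<N)) (trans (preserves F r x M≤x) (q x x<N))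
  ... | no  x≮N = e x (≮⇒≥ x≮N)

graph-framed : ∀ {m n} N (h : State m → State n) →
  (∀ s → AgreeFrom N (proj₂ s) (proj₂ (h s))) →
  (∀ i {ρ ρ′} → AgreeBelow N ρ ρ′ →
     proj₁ (h (i , ρ)) ≡ proj₁ (h (i , ρ′)) ×
     AgreeBelow N (proj₂ (h (i , ρ))) (proj₂ (h (i , ρ′)))) →
  Framed N (graph h)
graph-framed N h pres loc = record
  { preserves = λ {i} {j} {ρ} (_ , e) x N≤x → trans (pres (i , ρ) x N≤x) (sym (e x))
  ; transfer  = λ {i} {j} {ρ} {σ} {ρ′} {σ′} (j≡ , e) p q r →
      trans j≡ (proj₁ (loc i p)) , AgreeBelow∧AgreeFrom⇒≗ {N}
        (λ x x<N → trans (sym (q x x<N)) (trans (e x) (proj₂ (loc i p) x x<N)))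
        (λ x N≤x → trans (sym (r x N≤x)) (pres (i , ρ′) x N≤x))
  }

∘ᴿ-framed : ∀ {l m n N} {g : REL (State m) (State n) 0ℓ} {f : REL (State l) (State m) 0ℓ} →
            Framed N f → Framed N g → Framed N (g ∘ᴿ f)
∘ᴿ-framed {N = N} F G = record
  { preserves = λ (_ , r , r′) x N≤x → trans (preserves F r x N≤x) (preserves G r′ x N≤x)
  ; transfer  = λ {_} {_} {_} {_} {ρ′} ((k , τ) , r , r′) p q e →
      -- The intermediate store must have the high part of the new input, since neither relation
      -- changes it.
      (k , splice N τ ρ′) ,
      transfer F r p (splice-below N τ ρ′) (splice-from N τ ρ′) ,
      transfer G r′ (splice-below N τ ρ′) q
        (λ x N≤x → trans (sym (splice-from N τ ρ′ x N≤x)) (e x N≤x))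
  }

⊎ᴿ-framed : ∀ {m n m′ n′ N} {f : REL (State m) (State n) 0ℓ} {g : REL (State m′) (State n′) 0ℓ} →
            Framed N f → Framed N g → Framed N (f ⊎ᴿ g)
⊎ᴿ-framed {m} {n} {N = N} {f} {g} F G = record
  { preserves = λ {i} {j} → pres i j
  ; transfer  = λ {i} {j} → trans′ i j
  }
  where
  pres : ∀ i j {ρ σ} → (f ⊎ᴿ g) (i , ρ) (j , σ) → AgreeFrom N ρ σ
  pres i j r with splitAt m i | splitAt n j | r
  ... | left  _ | left  _ | leftᴾ  r′ = preserves F r′
  ... | right _ | right _ | rightᴾ r′ = preserves G r′

  trans′ : ∀ i j {ρ σ ρ′ σ′} → (f ⊎ᴿ g) (i , ρ) (j , σ) →
           AgreeBelow N ρ ρ′ → AgreeBelow N σ σ′ → AgreeFrom N ρ′ σ′ →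
           (f ⊎ᴿ g) (i , ρ′) (j , σ′)
  trans′ i j r p q e with splitAt m i | splitAt n j | r
  ... | left  _ | left  _ | leftᴾ  r′ = leftᴾ  (transfer F r′ p q e)
  ... | right _ | right _ | rightᴾ r′ = rightᴾ (transfer G r′ p q e)

Tr-framed : ∀ {m n N} k {f : REL (State (m + k)) (State (n + k)) 0ℓ} →
            Framed N f → Framed N (Tr k f)
Tr-framed {m} {n} {N} k {f} F = record { preserves = pres ; transfer = tran }
  where
  step : Rel (State k) 0ℓ
  step z z′ = f (inj₁ m z) (inj₁ n z′)

  star-pres : ∀ {z z′} → Star step z z′ → AgreeFrom N (proj₂ z) (proj₂ z′)
  star-pres ε        x N≤x = refl
  star-pres (r ◅ rs) x N≤x = trans (preserves F r x N≤x) (star-pres rs x N≤x)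

  pres : ∀ {i j ρ σ} → Tr k f (i , ρ) (j , σ) → AgreeFrom N ρ σ
  pres (left r) = preserves F r
  pres (right (_ , _ , r , rs , r′)) x N≤x =
    trans (preserves F r x N≤x) (trans (star-pres rs x N≤x) (preserves F r′ x N≤x))

  spliceᶻ : Store → State k → State k
  spliceᶻ ρ (i , τ) = i , splice N τ ρ

  -- All stores along the iteration receive the same high part, so each step transfers separately.
  star-splice : ∀ ρ {z z′} → Star step z z′ → Star step (spliceᶻ ρ z) (spliceᶻ ρ z′)
  star-splice ρ ε = ε
  star-splice ρ {_ , τ} (_◅_ {j = _ , τ′} r rs) =
    transfer F r (splice-below N τ ρ) (splice-below N τ′ ρ)
      (λ x N≤x → trans (sym (splice-from N τ ρ x N≤x)) (splice-from N τ′ ρ x N≤x))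
    ◅ star-splice ρ rs

  tran : ∀ {i j ρ σ ρ′ σ′} → Tr k f (i , ρ) (j , σ) →
         AgreeBelow N ρ ρ′ → AgreeBelow N σ σ′ → AgreeFrom N ρ′ σ′ →
         Tr k f (i , ρ′) (j , σ′)
  tran (left r) p q e = left (transfer F r p q e)
  tran {ρ′ = ρ′} (right (z₀@(_ , τ₀) , zₙ@(_ , τₙ) , r , rs , r′)) p q e =
    right (spliceᶻ ρ′ z₀ , spliceᶻ ρ′ zₙ ,
      transfer F r p (splice-below N τ₀ ρ′) (splice-from N τ₀ ρ′) ,
      star-splice ρ′ rs ,
      transfer F r′ (splice-below N τₙ ρ′) q
        (λ x N≤x → trans (sym (splice-from N τₙ ρ′ x N≤x)) (e x N≤x)))

[↦]-other : ∀ ρ {x y v} → y ≢ x → (ρ [ x ↦ v ]) y ≡ ρ y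
[↦]-other ρ {x} {y} y≢x rewrite dec-false (y ≟ x) y≢x = refl

[↦]-cong : ∀ {ρ σ x v w} y → v ≡ w → ρ y ≡ σ y → (ρ [ x ↦ v ]) y ≡ (σ [ x ↦ w ]) y
-- `does (y ≟ x)` computes to `y ≡ᵇ x`, so abstracting this Boolean reduces both updates at once.
[↦]-cong {x = x} y v≡w e with y ≡ᵇ x
... | true  = v≡w
... | false = e

module _ {E : Expressions} where
  open Expressions E

  framed : ∀ {m n} (A : Flowchart E m n) → ∃[ N ] Framed N ⟦ A ⟧
  framed ident = 0 , graph-framed 0 _ (λ _ _ _ → refl) (λ _ p → refl , p)
  framed join  = 0 , graph-framed 0 _ (λ _ _ _ → refl) (λ _ p → refl , p)
  framed twist = 0 , graph-framed 0 _ (λ _ _ _ → refl) (λ _ p → refl , p)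
  framed (cond b) with finB b
  ... | N , loc = N , graph-framed N _ (λ _ _ _ → refl) λ _ {ρ} {ρ′} p →
    cong (if_then suc zero else zero) (loc ρ ρ′ p) , p
  framed (assign x t) with finI t
  -- `suc x` puts the assigned variable below the bound, and `M` covers the variables of the
  -- expression.
  ... | M , loc = suc x ⊔ M , graph-framed (suc x ⊔ M) _
    (λ (_ , ρ) y N≤y → sym ([↦]-other ρ λ y≡x →
      <⇒≱ (≤-trans (m≤m⊔n (suc x) M) N≤y) (ℕ.≤-reflexive y≡x)))
    (λ _ {ρ} {ρ′} p → refl , λ y y<N →
      [↦]-cong {ρ} {ρ′} y (loc ρ ρ′ (AgreeBelow-weaken (m≤n⊔m (suc x) M) p)) (p y y<N))
  framed (Seq A B) with framed A | framed B
  ... | M , F | N , G = M ⊔ N ,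
    ∘ᴿ-framed (Framed-weaken (m≤m⊔n M N) F) (Framed-weaken (m≤n⊔m M N) G)
  framed (Par A B) with framed A | framed B
  ... | M , F | N , G = M ⊔ N ,
    ⊎ᴿ-framed (Framed-weaken (m≤m⊔n M N) F) (Framed-weaken (m≤n⊔m M N) G)
  framed (Fb k A) with framed A
  ... | N , F = N , Tr-framed k F

-- Weakest liberal preconditions

-- The store seen under `N` quantifiers: the bound variables take the first `N` values of `σ`, and
-- variable `x` of `ρ` moves to `N + x`.
prepend : ℕ → Store → Store → Store
prepend zero    σ ρ = ρ
prepend (suc N) σ ρ = σ 0 • prepend N (σ ∘ suc) ρ

prepend-below : ∀ N σ ρ → AgreeBelow N σ (prepend N σ ρ)
prepend-below (suc N) σ ρ zero    _     = refl
prepend-below (suc N) σ ρ (suc x) 1+x<N = prepend-below N (σ ∘ suc) ρ x (s≤s⁻¹ 1+x<N)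

prepend-+ : ∀ N σ ρ x → prepend N σ ρ (N + x) ≡ ρ x
prepend-+ zero    σ ρ x = refl
prepend-+ (suc N) σ ρ x = prepend-+ N (σ ∘ suc) ρ x

prepend-from : ∀ N σ σ′ ρ → AgreeFrom N (prepend N σ ρ) (prepend N σ′ ρ)
prepend-from N σ σ′ ρ x N≤x = subst (λ y → prepend N σ ρ y ≡ prepend N σ′ ρ y) (m+[n∸m]≡n N≤x)
  (trans (prepend-+ N σ ρ _) (sym (prepend-+ N σ′ ρ _)))

module _ {L : Language} where

  -- Each further quantifier goes innermost, where it binds index 0, the head added by `prepend`.
  ∀ⁿ : ℕ → Formula L → Formula L
  ∀ⁿ zero    φ = φ
  ∀ⁿ (suc N) φ = ∀ⁿ N (∀ᶠ φ)

  ⊨-∀ⁿ : ∀ N φ {ρ} → (ρ ⊨ ∀ⁿ N φ) ⇔ (∀ σ → prepend N σ ρ ⊨ φ)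
  ⊨-∀ⁿ zero    φ {ρ} = mk⇔ (λ a _ → a) (λ f → f ρ)
  ⊨-∀ⁿ (suc N) φ     = mk⇔ (λ a σ → to (⊨-∀ⁿ N (∀ᶠ φ)) a (σ ∘ suc) (σ 0))
                           (λ f → from (⊨-∀ⁿ N (∀ᶠ φ)) λ σ v → f (v • σ))

  infixr 6 _∧ᶠ_
  _∧ᶠ_ : Formula L → Formula L → Formula L
  φ ∧ᶠ ψ = (φ ⊃ ψ ⊃ ⊥ᶠ) ⊃ ⊥ᶠ

  -- Stability of both conjuncts makes the projections available from the negative encoding.
  ⊨-∧ᶠ : ∀ φ ψ {ρ} → (ρ ⊨ φ ∧ᶠ ψ) ⇔ (ρ ⊨ φ × ρ ⊨ ψ)
  ⊨-∧ᶠ φ ψ = mk⇔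
    (λ c → ⊨-stable φ (λ n → c λ a _ → n a) , ⊨-stable ψ (λ n → c λ _ b → n b))
    (λ (a , b) c → c a b)

  ⋀ : ∀ {n} → (Fin n → Formula L) → Formula L
  ⋀ {zero}  φ = ⊥ᶠ ⊃ ⊥ᶠ
  ⋀ {suc n} φ = φ zero ∧ᶠ ⋀ (φ ∘ suc)

  ⊨-⋀ : ∀ {n} (φ : Fin n → Formula L) {ρ} → (ρ ⊨ ⋀ φ) ⇔ (∀ i → ρ ⊨ φ i)
  ⊨-⋀ {zero}  φ = mk⇔ (λ _ ()) (λ _ ())
  ⊨-⋀ {suc n} φ {ρ} = mk⇔
    (λ a → λ { zero    → proj₁ (to (⊨-∧ᶠ (φ zero) (⋀ (φ ∘ suc))) a)
             ; (suc i) → to (⊨-⋀ (φ ∘ suc)) (proj₂ (to (⊨-∧ᶠ (φ zero) (⋀ (φ ∘ suc))) a)) i })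
    (λ f → from (⊨-∧ᶠ (φ zero) (⋀ (φ ∘ suc))) (f zero , from (⊨-⋀ (φ ∘ suc)) (f ∘ suc)))

  -- The variables from `N` up to `N + N` act as the logical variables of Hoare logic, remembering
  -- initial values.
  saved : ℕ → Formula L
  saved N = ⋀ {N} λ i → var (toℕ i) ≐ var (N + toℕ i)

  ⊨-saved : ∀ N {ρ : Store} → (ρ ⊨ saved N) ⇔ (∀ x → x < N → ρ x ≡ ρ (N + x))
  ⊨-saved N {ρ} = mk⇔
    (λ a x x<N → subst (λ y → ρ y ≡ ρ (N + y)) (toℕ-fromℕ< x<N) (to (⊨-⋀ _) a (fromℕ< x<N)))
    (λ f → from (⊨-⋀ {N} _) λ i → f (toℕ i) (toℕ<n i))

  -- With `⊥ᶠ` at every other entry, a strongest postcondition records only the runs that enter at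
  -- `i`.
  only : ∀ {n} → Fin n → Formula L → Assertion L n
  only {n} i φ = replicate n ⊥ᶠ [ i ]≔ φ

  ⊩-only : ∀ {n} (i : Fin n) φ {j ρ} → ((j , ρ) ⊩ only i φ) ⇔ (i ≡ j × ρ ⊨ φ)
  ⊩-only {n} i φ {j} {ρ} = mk⇔ only⇒
    (λ { (refl , a) → subst (ρ ⊨_) (sym (lookup∘update i (replicate n ⊥ᶠ) φ)) a })
    where
    only⇒ : (j , ρ) ⊩ only i φ → i ≡ j × ρ ⊨ φ
    only⇒ a with i Fin.≟ j
    ... | yes refl = refl , subst (ρ ⊨_) (lookup∘update i (replicate n ⊥ᶠ) φ) a
    ... | no  i≢j  = ⊥-elim (subst (ρ ⊨_)
      (trans (lookup∘update′ (i≢j ∘ sym) (replicate n ⊥ᶠ) φ) (lookup-replicate j ⊥ᶠ)) a)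

  ⊩-local : ∀ {n} (R : Assertion L n) → ∃[ N ] (∀ j → LocalBelow N (lookup R j))
  ⊩-local []      = 0 , λ ()
  ⊩-local (φ ∷ R) with ⊨-local φ | ⊩-local R
  ... | M , locφ | N , locR = M ⊔ N , λ where
    zero    → LocalBelow-weaken φ (m≤m⊔n M N) locφ
    (suc j) → LocalBelow-weaken (lookup R j) (m≤n⊔m M N) (locR j)

  WLP : ∀ {m n} → REL (State m) (State n) 0ℓ → Assertion L n → State m → Set
  WLP f R x = ∀ y → f x y → y ⊩ R

  wlp-expressible : ∀ {𝒯 : Theory L} {m n} {f : REL (State m) (State n) 0ℓ} →
    ∃[ N ] Framed N f → (∀ P → ∃[ S ] IsSPC 𝒯 f P S) →
    ∀ R i → ∃[ φ ] (∀ ρ → (ρ ⊨ φ) ⇔ WLP f R (i , ρ))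
  wlp-expressible {f = f} (N₁ , F₁) spc R i = ∀ⁿ N body , λ ρ → mk⇔ (⇒ ρ) (⇐ ρ)
    where
    N₂ = proj₁ (⊩-local R)
    -- The bound covers `R` too: `R` is evaluated in stores whose high part holds initial values
    -- rather than final ones.
    N  = N₁ ⊔ N₂

    F : Framed N f
    F = Framed-weaken (m≤m⊔n N₁ N₂) F₁

    localR : ∀ j → LocalBelow N (lookup R j)
    localR j = LocalBelow-weaken (lookup R j) (m≤n⊔m N₁ N₂) (proj₂ (⊩-local R) j)

    P S : Assertion L _
    P = only i (saved N)
    S = proj₁ (spc P)

    exact : ∀ y → y ⊩ S ⇔ Output f P y
    exact = IsSPC.exact (proj₂ (spc P))

    body : Formula L
    body = ⋀ λ j → lookup S j ⊃ lookup R j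

    ⇒ : ∀ ρ → ρ ⊨ ∀ⁿ N body → WLP f R (i , ρ)
    -- The run from `ρ` to `τ` transfers to one from `prepend N ρ ρ`, which satisfies `saved N`, to
    -- `prepend N τ ρ`; hence the quantified block is instantiated by `τ`.
    ⇒ ρ a (j , τ) r = localR j (AgreeBelow-sym (prepend-below N τ ρ))
      (to (⊨-⋀ _) (to (⊨-∀ⁿ N body) a τ) j (from (exact (j , prepend N τ ρ))
        ( (i , prepend N ρ ρ)
        , from (⊩-only i (saved N)) (refl , from (⊨-saved N)
            (λ x x<N → trans (sym (prepend-below N ρ ρ x x<N)) (sym (prepend-+ N ρ ρ x))))
        , transfer F r (prepend-below N ρ ρ) (prepend-below N τ ρ) (prepend-from N ρ τ ρ))))

    ⇐ : ∀ ρ → WLP f R (i , ρ) → ρ ⊨ ∀ⁿ N body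
    ⇐ ρ w = from (⊨-∀ⁿ N body) λ σ → from (⊨-⋀ _) λ j s → final σ j (to (exact _) s)
      where
      final : ∀ σ j → Output f P (j , prepend N σ ρ) → prepend N σ ρ ⊨ lookup R j
      final σ j ((i′ , κ) , κP , r) with to (⊩-only i (saved N)) κP
      ... | refl , κ-saved =
        -- Since `κ` and `ρ` agree below `N`, the run can be replayed from `ρ`. Its final store
        -- differs from `τ` only at variables that `R` cannot see.
        localR j (AgreeBelow-sym (splice-below N τ ρ))
          (w (j , splice N τ ρ) (transfer F r κ≡ρ (splice-below N τ ρ) (splice-from N τ ρ)))
        where
        τ = prepend N σ ρ
        κ≡ρ : AgreeBelow N κ ρ
        -- `κ x` equals `κ (N + x)`, which the run preserves, and the final store has `ρ x` at
        -- `N + x`.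
        κ≡ρ x x<N = trans (to (⊨-saved N) κ-saved x x<N)
          (trans (preserves F r (N + x) (m≤m+n N x)) (prepend-+ N σ ρ x))

-- Flowcharts that only reroute wires

module _ {E : Expressions} where

  Computes : ∀ {m n} → Flowchart E m n → (Fin m → Fin n) → Set
  Computes C h = ∀ {s t} → ⟦ C ⟧ s t ⇔ (t ≈ map₁ h s)

  Routable : ∀ {m n} → (Fin m → Fin n) → Set
  Routable h = ∃[ C ] Computes C h

  routable-cong : ∀ {m n} {h h′ : Fin m → Fin n} → h ≗ h′ → Routable h → Routable h′
  routable-cong e (C , c) = C , mk⇔
    (λ r → let (j≡ , σ≗) = to c r in trans j≡ (e _) , σ≗)
    (λ (j≡ , σ≗) → from c (trans j≡ (sym (e _)) , σ≗))

  routable-∘ : ∀ {l m n} {h : Fin m → Fin n} {g : Fin l → Fin m} →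
               Routable h → Routable g → Routable (h ∘ g)
  routable-∘ {h = h} {g} (D , d) (C , c) = Seq C D , mk⇔
    (λ (u , r , r′) → let (j≡ , σ≗) = to c r ; (k≡ , τ≗) = to d r′ in
      trans k≡ (cong h j≡) , λ x → trans (τ≗ x) (σ≗ x))
    (λ (j≡ , σ≗) → _ , from c (refl , λ _ → refl) , from d (j≡ , σ≗))

  routable-par : ∀ {m n m′ n′} {h : Fin m → Fin n} {g : Fin m′ → Fin n′} →
                 Routable h → Routable g →
                 Routable (Fin.join n n′ ∘ map⊎ h g ∘ splitAt m)
  routable-par {m} {n} {m′} {n′} {h} {g} (C , c) (D , d) = Par C D , λ {s} {t} → mk⇔
    (⊎ᴿ-elim _≋_
      (λ {x} {y} r → let (j≡ , σ≗) = to c r in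
        trans (cong (_↑ˡ n′) j≡) (cong route (sym (splitAt-↑ˡ m (proj₁ x) m′))) , σ≗)
      (λ {x} {y} r → let (j≡ , σ≗) = to d r in
        trans (cong (n ↑ʳ_) j≡) (cong route (sym (splitAt-↑ʳ m m′ (proj₁ x)))) , σ≗))
    (conv s t)
    where
    route : Fin m ⊎ Fin m′ → Fin (n + n′)
    route = Fin.join n n′ ∘ map⊎ h g

    _≋_ : REL (State (m + m′)) (State (n + n′)) 0ℓ
    s ≋ t = t ≈ map₁ (route ∘ splitAt m) s

    conv : ∀ s t → s ≋ t → (⟦ C ⟧ ⊎ᴿ ⟦ D ⟧) s t
    conv (i , ρ) (j , σ) (refl , σ≗)
      rewrite splitAt-join n n′ (map⊎ h g (splitAt m i)) with splitAt m i
    ... | left  _ = leftᴾ  (from c (refl , σ≗))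
    ... | right _ = rightᴾ (from d (refl , σ≗))

  routable-ident : Routable {1} id
  routable-ident = ident , mk⇔ id id

  routable-id : ∀ n → Routable {n} id
  -- Closing the single wire of `ident` by feedback gives a chart without wires; the claim is
  -- vacuous as `State 0` is empty.
  routable-id zero    = Fb 1 ident , λ { {() , _} }
  routable-id (suc n) = routable-cong (join-splitAt 1 n)
    (routable-cong (λ i → cong (Fin.join 1 n) (map⊎-id (splitAt 1 i)))
      (routable-par routable-ident (routable-id n)))
    where
    map⊎-id : ∀ {A B : Set} (x : A ⊎ B) → map⊎ id id x ≡ x
    map⊎-id (left  _) = refl
    map⊎-id (right _) = refl

  mergeInto : ∀ {n} → Fin n → Fin (suc n) → Fin n
  mergeInto j zero    = j
  mergeInto j (suc i) = i

  -- Twists carry the first wire past its neighbours until it is next to its target, where `join`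
  -- absorbs it.
  routable-mergeInto : ∀ {n} (j : Fin n) → Routable (mergeInto j)
  routable-mergeInto {suc n} zero = routable-cong
    (λ { zero → refl ; (suc zero) → refl ; (suc (suc i)) → refl })
    (routable-par routable-join (routable-id n))
    where
    routable-join : Routable {2} {1} (λ _ → zero)
    routable-join = join , mk⇔ id id
  routable-mergeInto {suc n} (suc j) = routable-cong
    (λ { zero → refl ; (suc zero) → refl ; (suc (suc i)) → refl })
    (routable-∘ (routable-par routable-ident (routable-mergeInto j))
                (routable-par routable-twist (routable-id n)))
    where
    routable-twist : Routable {2} Fin.opposite
    routable-twist = twist , mk⇔ id id

  routable-merge : ∀ k {n} (g : Fin k → Fin n) → Routable (either g id ∘ splitAt k)
  routable-merge zero    {n} g = routable-id n
  routable-merge (suc k) {n} g = routable-cong eq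
    -- The first extra wire is merged before the others, so its target still lies behind the
    -- remaining `k` extra wires.
    (routable-∘ (routable-merge k (g ∘ suc)) (routable-mergeInto (k ↑ʳ g zero)))
    where
    eq : either (g ∘ suc) id ∘ splitAt k ∘ mergeInto (k ↑ʳ g zero) ≗ either g id ∘ splitAt (suc k)
    eq zero    = cong (either (g ∘ suc) id) (splitAt-↑ʳ k n (g zero))
    eq (suc i) with splitAt k i
    ... | left  _ = refl
    ... | right _ = refl

  routable-cast : ∀ {m n} (eq : m ≡ n) → Routable (cast eq)
  routable-cast {m} refl = routable-cong (sym ∘ cast-is-id refl) (routable-id m)

  -- Routing fixes the intermediate state only up to `≈`, and framing of `A` shows that `⟦ A ⟧`
  -- respects this.
  Seq-routing : ∀ {l m n} {h : Fin l → Fin m} (C : Routable h) (A : Flowchart E m n) →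
                ∀ {s t} → ⟦ Seq (proj₁ C) A ⟧ s t ⇔ ⟦ A ⟧ (map₁ h s) t
  Seq-routing (C , c) A = mk⇔
    (λ (u , r , r′) → resp-≈ (proj₂ (framed A)) (to c r) (refl , λ _ → refl) r′)
    (λ r → _ , from c (refl , λ _ → refl) , r)

-- Feedback

module _ {L : Language} {E : Expressions} {m n : ℕ} (k : ℕ) (A : Flowchart E (m + k) (n + k)) where

  Step : Rel (State k) 0ℓ
  Step z z′ = ⟦ A ⟧ (inj₁ m z) (inj₁ n z′)

  -- The runs of the loop entered at a feedback wire. The weakest liberal precondition of this
  -- relation is the invariant.
  Exit : REL (State k) (State n) 0ℓ
  Exit z y = ∃[ zₙ ] Star Step z zₙ × ⟦ A ⟧ (inj₁ m zₙ) (inj₀ k y)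

  -- The wires are `k` new entries, the `m` original inputs and the `k` feedback wires; the new
  -- entries are joined onto the feedback wires.
  enterLoop : Fin ((k + m) + k) → Fin (m + k)
  enterLoop = either (m ↑ʳ_) id ∘ splitAt k ∘ cast (+-assoc k m k)

  enterLoop-entry : ∀ i → enterLoop ((i ↑ˡ m) ↑ˡ k) ≡ m ↑ʳ i
  enterLoop-entry i = trans
    (cong (either (m ↑ʳ_) id ∘ splitAt k) (toℕ-injective {j = i ↑ˡ (m + k)} (trans (toℕ-cast _ _)
      (trans (toℕ-↑ˡ (i ↑ˡ m) k) (trans (toℕ-↑ˡ i m) (sym (toℕ-↑ˡ i (m + k))))))))
    (cong (either (m ↑ʳ_) id) (splitAt-↑ˡ k i (m + k)))

  enterLoop-feedback : ∀ i → enterLoop ((k + m) ↑ʳ i) ≡ m ↑ʳ i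
  enterLoop-feedback i = trans
    (cong (either (m ↑ʳ_) id ∘ splitAt k) (toℕ-injective {j = k ↑ʳ (m ↑ʳ i)} (trans (toℕ-cast _ _)
      (trans (toℕ-↑ʳ (k + m) i) (trans (+-assoc k m (toℕ i))
        (sym (trans (toℕ-↑ʳ k (m ↑ʳ i)) (cong (k +_) (toℕ-↑ʳ m i)))))))))
    (cong (either (m ↑ʳ_) id) (splitAt-↑ʳ k (m + k) (m ↑ʳ i)))

  routable-enterLoop : Routable {E} enterLoop
  routable-enterLoop = routable-∘ (routable-merge k (m ↑ʳ_)) (routable-cast (+-assoc k m k))

  -- Inputs k, …, k + m ∸ 1 are unused: without a cond no flowchart has fewer inputs
  -- than outputs, so they cannot be dropped.
  loop : Flowchart E (k + m) n
  loop = Fb k (Seq (proj₁ routable-enterLoop) A)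

  private
    A-entry : ∀ {z t} → ⟦ Seq (proj₁ routable-enterLoop) A ⟧ (inj₀ k (inj₀ m z)) t
                      ⇔ ⟦ A ⟧ (inj₁ m z) t
    A-entry {i , ρ} {t} rewrite sym (enterLoop-entry i) = Seq-routing routable-enterLoop A

    A-feedback : ∀ {z t} → ⟦ Seq (proj₁ routable-enterLoop) A ⟧ (inj₁ (k + m) z) t
                         ⇔ ⟦ A ⟧ (inj₁ m z) t
    A-feedback {i , ρ} {t} rewrite sym (enterLoop-feedback i) =
      Seq-routing routable-enterLoop A

  -- After routing, a new entry and its feedback wire behave alike, so the initial transition from
  -- the entry becomes the first step of the `Star`, or the exit itself if the `Star` is empty.
  loop⇔Exit : ∀ {z y} → ⟦ loop ⟧ (inj₀ m z) y ⇔ Exit z y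
  loop⇔Exit {z} {y} = mk⇔
    (λ { (left r) → z , ε , to A-entry r
       ; (right (z₀ , zₙ , r , rs , r′)) →
           zₙ , to A-entry r ◅ Star.map (to A-feedback) rs , to A-feedback r′ })
    (λ { (_ , ε , r) → left (from A-entry r)
       ; (zₙ , r ◅ rs , r′) →
           right (_ , zₙ , from A-entry r , Star.map (from A-feedback) rs , from A-feedback r′) })

  module _ (P : Assertion L m) (R : Assertion L n) where

    invariant⇒Tr : ∀ Q → Triple ⟦ A ⟧ (P ++ Q) (R ++ Q) → Triple (Tr k ⟦ A ⟧) P R
    invariant⇒Tr Q triple {x} {y} xP (left r) =
      to (⊩-inj₀ R Q y) (triple (from (⊩-inj₀ P Q x) xP) r)
    invariant⇒Tr Q triple {x} {y} xP (right (z₀ , zₙ , r , rs , r′)) =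
      to (⊩-inj₀ R Q y) (triple (from (⊩-inj₁ P Q zₙ) (along rs
        (to (⊩-inj₁ R Q z₀) (triple (from (⊩-inj₀ P Q x) xP) r)))) r′)
      where
      along : ∀ {z z′} → Star Step z z′ → z ⊩ Q → z′ ⊩ Q
      along ε        zQ = zQ
      along (r ◅ rs) zQ = along rs (to (⊩-inj₁ R Q _) (triple (from (⊩-inj₁ P Q _) zQ) r))

    -- One case for each kind of transition of `A`. Putting the transition in front of an exiting
    -- run gives a longer run of `Exit` or of the trace, to which the assumption on its start
    -- applies.
    wlp-invariant : ∀ Q → (∀ z → z ⊩ Q ⇔ WLP Exit R z) →
                    Triple (Tr k ⟦ A ⟧) P R → Triple ⟦ A ⟧ (P ++ Q) (R ++ Q)
    wlp-invariant Q wlp triple {s} {t} sP r with sumView {m} s | sumView {n} t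
    ... | in₀ x | in₀ y = from (⊩-inj₀ R Q y) (triple (to (⊩-inj₀ P Q x) sP) (left r))
    ... | in₀ x | in₁ z = from (⊩-inj₁ R Q z) (from (wlp z) λ y (zₙ , rs , r′) →
      triple (to (⊩-inj₀ P Q x) sP) (right (z , zₙ , r , rs , r′)))
    ... | in₁ z | in₀ y = from (⊩-inj₀ R Q y)
      (to (wlp z) (to (⊩-inj₁ P Q z) sP) y (z , ε , r))
    ... | in₁ z | in₁ z′ = from (⊩-inj₁ R Q z′) (from (wlp z′) λ y (zₙ , rs , r′) →
      to (wlp z) (to (⊩-inj₁ P Q z) sP) y (zₙ , r ◅ rs , r′))

  Exit-wlp : ∀ {𝒯 : Theory L} → CookExpressive E 𝒯 →
             ∀ R → ∃[ Q ] (∀ z → z ⊩ Q ⇔ WLP Exit R z)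
  Exit-wlp cook R = tabulate (λ i → proj₁ (φ i)) , λ (i , ρ) → mk⇔
    (λ a y e → to (proj₂ (φ i) ρ) (subst (ρ ⊨_) (lookup∘tabulate _ i) a) y (from loop⇔Exit e))
    (λ w → subst (ρ ⊨_) (sym (lookup∘tabulate _ i))
      (from (proj₂ (φ i) ρ) λ y r → w y (to loop⇔Exit r)))
    where
    φ : ∀ i → ∃[ φ ] (∀ ρ → (ρ ⊨ φ) ⇔ WLP ⟦ loop ⟧ R (i ↑ˡ m , ρ))
    φ i = wlp-expressible (framed loop) (cook loop) R (i ↑ˡ m)

-- The three laws of a verification functor, reduced to Hoare triples

theorem4p2 : (L : Language) (E : Expressions) (𝒯 : Theory L) →
    TrueInℤ 𝒯 → CookExpressive E 𝒯 →
    (∀ {l m n} (A : Flowchart E l m) (B : Flowchart E m n) →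
    ∀ P R → H 𝒯 ⟦ Seq A B ⟧ P R ⇔ (H 𝒯 ⟦ B ⟧ ∘ᴿ H 𝒯 ⟦ A ⟧) P R)
    × (∀ {m n m′ n′} (A : Flowchart E m n) (B : Flowchart E m′ n′) →
    ∀ P P′ R R′ →
    H 𝒯 ⟦ Par A B ⟧ (P ++ P′) (R ++ R′) ⇔ (H 𝒯 ⟦ A ⟧ P R × H 𝒯 ⟦ B ⟧ P′ R′))
    × (∀ {m n} k (A : Flowchart E (m + k) (n + k)) →
    ∀ P R →
    H 𝒯 ⟦ Fb k A ⟧ P R ⇔ (∃[ Q ] H 𝒯 ⟦ A ⟧ (P ++ Q) (R ++ Q)))
theorem4p2 L E 𝒯 valid cook = seq , par , fb
  where
  H⇔ : ∀ {m n} (A : Flowchart E m n) P Q → H 𝒯 ⟦ A ⟧ P Q ⇔ Triple ⟦ A ⟧ P Q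
  H⇔ A P Q = H⇔Triple valid {Q = Q} (cook A P)

  seq : ∀ {l m n} (A : Flowchart E l m) (B : Flowchart E m n) →
        ∀ P R → H 𝒯 ⟦ Seq A B ⟧ P R ⇔ (H 𝒯 ⟦ B ⟧ ∘ᴿ H 𝒯 ⟦ A ⟧) P R
  seq A B P R = mk⇔ ⇒ ⇐
    where
    ⇒ : H 𝒯 ⟦ Seq A B ⟧ P R → (H 𝒯 ⟦ B ⟧ ∘ᴿ H 𝒯 ⟦ A ⟧) P R
    ⇒ h with cook A P
    -- The intermediate assertion is the strongest postcondition of `A`: exactness traces each state
    -- satisfying it back to an input in `P`.
    ... | S , spc = S ,
      from (H⇔ A P S) (λ {x} {y} xP r → from (IsSPC.exact spc y) (x , xP , r)) ,
      from (H⇔ B S R) (λ {y} {z} yS r′ → let (x , xP , r) = to (IsSPC.exact spc y) yS in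
        to (H⇔ (Seq A B) P R) h xP (y , r , r′))

    ⇐ : (H 𝒯 ⟦ B ⟧ ∘ᴿ H 𝒯 ⟦ A ⟧) P R → H 𝒯 ⟦ Seq A B ⟧ P R
    ⇐ (Q , hA , hB) = from (H⇔ (Seq A B) P R) λ xP (_ , r , r′) → to (H⇔ B Q R) hB (to (H⇔ A P Q) hA xP r) r′

  par : ∀ {m n m′ n′} (A : Flowchart E m n) (B : Flowchart E m′ n′) → ∀ P P′ R R′ →
        H 𝒯 ⟦ Par A B ⟧ (P ++ P′) (R ++ R′) ⇔ (H 𝒯 ⟦ A ⟧ P R × H 𝒯 ⟦ B ⟧ P′ R′)
  par A B P P′ R R′ = mk⇔
    (λ h →
      from (H⇔ A P R) (λ xP r → to (⊩-inj₀ R R′ _)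
        (to (H⇔ (Par A B) (P ++ P′) (R ++ R′)) h (from (⊩-inj₀ P P′ _) xP) (⊎ᴿ-inj₀ r))) ,
      from (H⇔ B P′ R′) (λ xP r → to (⊩-inj₁ R R′ _)
        (to (H⇔ (Par A B) (P ++ P′) (R ++ R′)) h (from (⊩-inj₁ P P′ _) xP) (⊎ᴿ-inj₁ r))))
    (λ (hA , hB) → from (H⇔ (Par A B) (P ++ P′) (R ++ R′)) λ sP r →
      ⊎ᴿ-elim (λ s t → s ⊩ (P ++ P′) → t ⊩ (R ++ R′))
        (λ r sP → from (⊩-inj₀ R R′ _) (to (H⇔ A P R) hA (to (⊩-inj₀ P P′ _) sP) r))
        (λ r sP → from (⊩-inj₁ R R′ _) (to (H⇔ B P′ R′) hB (to (⊩-inj₁ P P′ _) sP) r))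
        r sP)

  fb : ∀ {m n} k (A : Flowchart E (m + k) (n + k)) → ∀ P R →
       H 𝒯 ⟦ Fb k A ⟧ P R ⇔ (∃[ Q ] H 𝒯 ⟦ A ⟧ (P ++ Q) (R ++ Q))
  fb k A P R = mk⇔
    -- The invariant depends on `R` and `A` only; `P` enters through the triple for the feedback.
    (λ h → let (Q , wlp) = Exit-wlp k A cook R in
      Q , from (H⇔ A (P ++ Q) (R ++ Q)) (wlp-invariant k A P R Q wlp (to (H⇔ (Fb k A) P R) h)))
    (λ (Q , h) → from (H⇔ (Fb k A) P R) (invariant⇒Tr k A P R Q (to (H⇔ A (P ++ Q) (R ++ Q)) h)))
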